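{- For almost all graphs $G$ with $n$ vertices, we have $$\ell(G) \geq n - (2 \log_2 n + 2 \log_2 \log_2 n).$$ That is, the probability that the random graph $G=G(n,1/2)$ satisfies this inequality tends to $1$ as $n\to\infty$.
   Context: All graphs are finite and simple. Given a finite alphabet $\Sigma$, a decoder is a set of ordered pairs $D\subseteq\Sigma^2$. For a word $w$ with letters $w(1),\dots,w(n)\in\Sigma$, the letter graph $\Gamma_D(w)$ is the graph with vertex set $\{1,\dots,n\}$ and with an edge $ij$ for each $i<j$ such that $(w(i),w(j))\in D$. If $|\Sigma|=k$, then $\Gamma_D(w)$ is called a $k$-letter graph. The lettericity $\ell(G)$ of a graph $G$ is the least integer $k$ such that $G$ is isomorphic to a $k$-letter graph. The random graph $G(n,1/2)$ is the graph on $n$ labeled vertices in which each edge appears independently with probability $1/2$ (so every labeled $n$-vertex graph occurs with equal probability). -}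

module Defs where

open import Data.Bool.Base using (Bool; true; false)
import Data.Bool.Properties as Bool
open import Data.Fin.Base using (Fin; zero; suc)
open import Data.Fin.Permutation
  using (Permutation′; permutation; _⟨$⟩ʳ_; _⟨$⟩ˡ_; inverseˡ; inverseʳ) renaming (id to idₚ)
import Data.Fin.Properties as Fin
open import Data.Integer.Base using (ℤ; +_; -[1+_])
open import Data.List.Base using (List; []; _∷_; cartesianProductWith; filter; length)
open import Data.List.Membership.Propositional using (_∈_)
open import Data.List.Membership.Propositional.Properties using (∈-cartesianProductWith⁺)
import Data.List.Membership.Setoid as Membership
import Data.List.Membership.Setoid.Properties as Membershipₚ
open import Data.List.Relation.Unary.All using ([]; _∷_)
open import Data.List.Relation.Unary.AllPairs using ([]; _∷_)
open import Data.List.Relation.Unary.Any using (Any; here; there)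
import Data.List.Relation.Unary.Unique.Propositional as Unique≡
import Data.List.Relation.Unary.Unique.Propositional.Properties as Unique≡ₚ
import Data.List.Relation.Unary.Unique.Setoid as Uniqueₛ
import Data.List.Relation.Unary.Unique.Setoid.Properties as Uniqueₛₚ
open import Data.Nat.Base as ℕ using (ℕ; zero; suc; NonZero)
import Data.Nat.Properties as ℕ
open import Data.Product.Base using (Σ-syntax; ∃-syntax; ∃; _×_; _,_; proj₁; proj₂)
open import Data.Rational.Unnormalised.Base as ℚ using (ℚᵘ; 0ℚᵘ; 1ℚᵘ; ↥_; ↧ₙ_)
open import Data.Sum.Base using (_⊎_; inj₁; inj₂)
open import Data.Vec.Base as Vec using (Vec; []; _∷_; lookup)
import Data.Vec.Functional as Vector
import Data.Vec.Properties as Vec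
open import Function.Base using (id; _∘_)
open import Level using (0ℓ)
open import Relation.Binary.Bundles using (Setoid)
open import Relation.Binary.Core using (Rel)
open import Relation.Binary.Definitions using (tri<; tri≈; tri>)
open import Relation.Binary.PropositionalEquality
  using (_≡_; refl; sym; trans; cong; cong₂; subst; setoid)
open import Relation.Nullary using (Dec; yes; no; contradiction; map′; _×-dec_)
open import Relation.Unary using (Pred; Decidable; _⊆_)

record Graph (n : ℕ) : Set where
  field
    adj        : Fin n → Fin n → Bool
    adj-sym    : ∀ i j → adj i j ≡ adj j i
    adj-irrefl : ∀ i → adj i i ≡ false

open Graph public

infix 4 _≈ᴳ_ _≅_

-- The same labelled graph (no function extensionality is available).
_≈ᴳ_ : ∀ {n} → Rel (Graph n) 0ℓ
G ≈ᴳ H = ∀ i j → adj G i j ≡ adj H i j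

_≅_ : ∀ {n} → Rel (Graph n) 0ℓ
_≅_ {n} G H = Σ[ π ∈ Permutation′ n ] (∀ i j → adj H (π ⟨$⟩ʳ i) (π ⟨$⟩ʳ j) ≡ adj G i j)

Decoder : ℕ → Set
Decoder k = Fin k → Fin k → Bool

Word : ℕ → ℕ → Set
Word k n = Fin n → Fin k

letterAdj : ∀ {k n} → Decoder k → Word k n → Fin n → Fin n → Bool
letterAdj D w i j with Fin.<-cmp i j
... | tri< _ _ _ = D (w i) (w j)
... | tri≈ _ _ _ = false
... | tri> _ _ _ = D (w j) (w i)

Γ : ∀ {k n} → Decoder k → Word k n → Graph n
Γ D w .adj = letterAdj D w
Γ D w .adj-sym i j with Fin.<-cmp i j | Fin.<-cmp j i
... | tri< _   _ _   | tri> _   _ _   = refl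
... | tri≈ _   _ _   | tri≈ _   _ _   = refl
... | tri> _   _ _   | tri< _   _ _   = refl
... | tri< i<j _ _   | tri< _   _ j≯i = contradiction i<j j≯i
... | tri< _ i≢j _   | tri≈ _ j≡i _   = contradiction (sym j≡i) i≢j
... | tri≈ _ i≡j _   | tri< _ j≢i _   = contradiction (sym i≡j) j≢i
... | tri≈ _ i≡j _   | tri> _ j≢i _   = contradiction (sym i≡j) j≢i
... | tri> _ i≢j _   | tri≈ _ j≡i _   = contradiction (sym j≡i) i≢j
... | tri> i≮j _ _   | tri> _   _ i<j = contradiction i<j i≮j
Γ D w .adj-irrefl i with Fin.<-cmp i i
... | tri< _ i≢i _ = contradiction refl i≢i
... | tri≈ _ _ _   = refl
... | tri> _ i≢i _ = contradiction refl i≢i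

-- An isomorphism forces the word to have exactly one letter per vertex.
IsLetterGraph : ∀ {n} → ℕ → Graph n → Set
IsLetterGraph {n} k G = Σ[ D ∈ Decoder k ] Σ[ w ∈ Word k n ] G ≅ Γ D w

IsLettericity : ∀ {n} → Graph n → ℕ → Set
IsLettericity G k = IsLetterGraph k G × (∀ j → IsLetterGraph j G → k ℕ.≤ j)

-- Lettericity as a function: being a k-letter graph is decidable by
-- exhaustive search, and every graph on n vertices is an n-letter graph.

private

  Searchable : (A : Set) → Rel A 0ℓ → Set₁
  Searchable A _~_ = ∀ {P : Pred A 0ℓ} → (∀ {a b} → a ~ b → P a → P b) →
                     Decidable P → Dec (∃ P)

  Pointwise : ∀ {A : Set} {n} → Rel A 0ℓ → Rel (Fin n → A) 0ℓ
  Pointwise _~_ f g = ∀ i → f i ~ g i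

  search-Bool : Searchable Bool _≡_
  search-Bool _ P? with P? true | P? false
  ... | yes p | _     = yes (true , p)
  ... | no _  | yes p = yes (false , p)
  ... | no ¬p | no ¬q = no λ { (true , p) → ¬p p ; (false , q) → ¬q q }

  search-Fin : ∀ {n} → Searchable (Fin n) _≡_
  search-Fin _ = Fin.any?

  search-→ : ∀ {A : Set} {_~_ : Rel A 0ℓ} → (∀ {a} → a ~ a) → Searchable A _~_ →
             ∀ {n} → Searchable (Fin n → A) (Pointwise _~_)
  search-→ ~-refl search {zero} resp P? =
    map′ (λ p → Vector.[] , p) (λ (_ , p) → resp (λ ()) p) (P? Vector.[])
  search-→ {A} {_~_} ~-refl search {suc n} {P} resp P? =
    map′ (λ (a , f , p) → (a Vector.∷ f) , p)
         (λ (g , p) → g zero , g ∘ suc , resp (λ { zero → ~-refl ; (suc _) → ~-refl }) p)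
         (search (λ a~b (f , p) → f , resp (λ { zero → a~b ; (suc _) → ~-refl }) p)
           λ a → search-→ ~-refl search
             (λ f~g → resp λ { zero → ~-refl ; (suc i) → f~g i })
             λ f → P? (a Vector.∷ f))

  letterAdj-cong : ∀ {k n} (D E : Decoder k) (v w : Word k n) →
                   (∀ a b → D a b ≡ E a b) → (∀ i → v i ≡ w i) →
                   ∀ i j → letterAdj D v i j ≡ letterAdj E w i j
  letterAdj-cong D E v w D≗E v≗w i j with Fin.<-cmp i j
  ... | tri< _ _ _ = trans (D≗E _ _) (cong₂ E (v≗w i) (v≗w j))
  ... | tri≈ _ _ _ = refl
  ... | tri> _ _ _ = trans (D≗E _ _) (cong₂ E (v≗w j) (v≗w i))

  infix 4 _≅?_

  _≅?_ : ∀ {n} (G H : Graph n) → Dec (G ≅ H)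
  _≅?_ {n} G H = map′ to from
    (search-→ refl search-Fin
      (λ f≗f′ (g , fg , gf , iso) → g
        , (λ i → trans (sym (f≗f′ _)) (fg i))
        , (λ i → trans (cong g (sym (f≗f′ i))) (gf i))
        , (λ i j → trans (sym (cong₂ (adj H) (f≗f′ i) (f≗f′ j))) (iso i j)))
      λ f → search-→ refl search-Fin
        (λ g≗g′ (fg , gf , iso) →
            (λ i → trans (cong f (sym (g≗g′ i))) (fg i))
          , (λ i → trans (sym (g≗g′ _)) (gf i))
          , iso)
        λ g → Fin.all? (λ i → f (g i) Fin.≟ i)
          ×-dec Fin.all? (λ i → g (f i) Fin.≟ i)
          ×-dec Fin.all? (λ i → Fin.all? λ j → adj H (f i) (f j) Bool.≟ adj G i j))
    where
    Inverses : Set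
    Inverses = Σ[ f ∈ (Fin n → Fin n) ] Σ[ g ∈ (Fin n → Fin n) ]
      ((∀ i → f (g i) ≡ i) × (∀ i → g (f i) ≡ i) ×
       (∀ i j → adj H (f i) (f j) ≡ adj G i j))

    to : Inverses → G ≅ H
    to (f , g , fg , gf , iso) = permutation f g fg gf , iso

    from : G ≅ H → Inverses
    from (π , iso) =
      (π ⟨$⟩ʳ_) , (π ⟨$⟩ˡ_) , (λ _ → inverseʳ π) , (λ _ → inverseˡ π) , iso

  least : ∀ {P : Pred ℕ 0ℓ} → Decidable P → ∃ P → ∃[ k ] (P k × (∀ j → P j → k ℕ.≤ j))
  least {P} P? (n , p) with go n
    where
    go : ∀ n → (∃[ k ] (P k × (∀ j → P j → k ℕ.≤ j))) ⊎ (∀ j → P j → n ℕ.≤ j)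
    go zero = inj₂ λ _ _ → ℕ.z≤n
    go (suc n) with go n | P? n
    ... | inj₁ found | _     = inj₁ found
    ... | inj₂ none  | yes p = inj₁ (n , p , none)
    ... | inj₂ none  | no ¬p = inj₂ λ j q →
      ℕ.≤∧≢⇒< (none j q) λ n≡j → ¬p (subst P (sym n≡j) q)
  ... | inj₁ found = found
  ... | inj₂ none  = n , p , none

isLetterGraph? : ∀ {n} (G : Graph n) → Decidable (λ k → IsLetterGraph k G)
isLetterGraph? G k =
  search-→ (λ _ → refl) (search-→ refl search-Bool)
    (λ {D} {E} D≗E (w , π , iso) → w , π , λ i j →
      trans (sym (letterAdj-cong D E w w D≗E (λ _ → refl) (π ⟨$⟩ʳ i) (π ⟨$⟩ʳ j))) (iso i j))
    λ D → search-→ refl search-Fin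
      (λ {v} {w} v≗w (π , iso) → π , λ i j →
        trans (sym (letterAdj-cong D D v w (λ _ _ → refl) v≗w (π ⟨$⟩ʳ i) (π ⟨$⟩ʳ j))) (iso i j))
      λ w → G ≅? Γ D w

isLetterGraph-n : ∀ {n} (G : Graph n) → IsLetterGraph n G
isLetterGraph-n G = adj G , id , idₚ , iso
  where
  iso : ∀ i j → letterAdj (adj G) id i j ≡ adj G i j
  iso i j with Fin.<-cmp i j
  ... | tri< _ _    _ = refl
  ... | tri≈ _ refl _ = sym (adj-irrefl G i)
  ... | tri> _ _    _ = adj-sym G j i

lettericity : ∀ {n} (G : Graph n) → ∃ (IsLettericity G)
lettericity G = least (isLetterGraph? G) (_ , isLetterGraph-n G)

ℓ : ∀ {n} → Graph n → ℕ
ℓ G = proj₁ (lettericity G)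

ℓ-isLettericity : ∀ {n} (G : Graph n) → IsLettericity G (ℓ G)
ℓ-isLettericity G = proj₂ (lettericity G)

bitVectors : ∀ n → List (Vec Bool n)
bitVectors zero    = [] ∷ []
bitVectors (suc n) = cartesianProductWith _∷_ (true ∷ false ∷ []) (bitVectors n)

empty : Graph 0
empty = record { adj = λ () ; adj-sym = λ () ; adj-irrefl = λ () }

-- Add a new vertex zero whose neighbours are given by the bit vector.
extend : ∀ {n} → Vec Bool n → Graph n → Graph (suc n)
extend v G .adj zero    zero    = false
extend v G .adj zero    (suc j) = lookup v j
extend v G .adj (suc i) zero    = lookup v i
extend v G .adj (suc i) (suc j) = adj G i j
extend v G .adj-sym zero    zero    = refl
extend v G .adj-sym zero    (suc j) = refl
extend v G .adj-sym (suc i) zero    = refl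
extend v G .adj-sym (suc i) (suc j) = adj-sym G i j
extend v G .adj-irrefl zero    = refl
extend v G .adj-irrefl (suc i) = adj-irrefl G i

allGraphs : ∀ n → List (Graph n)
allGraphs zero    = empty ∷ []
allGraphs (suc n) = cartesianProductWith extend (bitVectors n) (allGraphs n)

-- allGraphs n lists every labelled graph exactly once (allGraphs-complete,
-- allGraphs-unique), so counting in it gives the uniform distribution.

graphSetoid : ℕ → Setoid 0ℓ 0ℓ
graphSetoid n = record
  { Carrier = Graph n
  ; _≈_ = _≈ᴳ_
  ; isEquivalence = record
    { refl  = λ _ _ → refl
    ; sym   = λ p i j → sym (p i j)
    ; trans = λ p q i j → trans (p i j) (q i j)
    }
  }

bitVectors-complete : ∀ {n} (v : Vec Bool n) → v ∈ bitVectors n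
bitVectors-complete []       = here refl
bitVectors-complete (b ∷ v) = ∈-cartesianProductWith⁺ _∷_ (bit b) (bitVectors-complete v)
  where
  bit : ∀ b → b ∈ (true ∷ false ∷ [])
  bit true  = here refl
  bit false = there (here refl)

bitVectors-unique : ∀ n → Unique≡.Unique (bitVectors n)
bitVectors-unique zero    = [] ∷ []
bitVectors-unique (suc n) =
  Unique≡ₚ.cartesianProductWith⁺ _∷_ Vec.∷-injective
    (((λ ()) ∷ []) ∷ [] ∷ []) (bitVectors-unique n)

allGraphs-complete : ∀ {n} (G : Graph n) → Membership._∈_ (graphSetoid n) G (allGraphs n)
allGraphs-complete {zero}  G = here λ ()
allGraphs-complete {suc n} G =
  Membershipₚ.∈-resp-≈ S′ {x = extend v H} {y = G} rebuild
    (Membershipₚ.∈-cartesianProductWith⁺ (setoid _) (graphSetoid n) S′ extend-cong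
      (bitVectors-complete v) (allGraphs-complete H))
  where
  S′ = graphSetoid (suc n)

  v : Vec Bool n
  v = Vec.tabulate (adj G zero ∘ suc)

  H : Graph n
  H = record
    { adj        = λ i j → adj G (suc i) (suc j)
    ; adj-sym    = λ i j → adj-sym G (suc i) (suc j)
    ; adj-irrefl = λ i → adj-irrefl G (suc i)
    }

  extend-cong : ∀ {u v : Vec Bool n} {G H : Graph n} → u ≡ v → G ≈ᴳ H → extend u G ≈ᴳ extend v H
  extend-cong refl G≈H zero    zero    = refl
  extend-cong refl G≈H zero    (suc j) = refl
  extend-cong refl G≈H (suc i) zero    = refl
  extend-cong refl G≈H (suc i) (suc j) = G≈H i j

  rebuild : ∀ i j → adj (extend v H) i j ≡ adj G i j
  rebuild zero    zero    = sym (adj-irrefl G zero)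
  rebuild zero    (suc j) = Vec.lookup∘tabulate _ j
  rebuild (suc i) zero    = trans (Vec.lookup∘tabulate _ i) (adj-sym G zero (suc i))
  rebuild (suc i) (suc j) = refl

allGraphs-unique : ∀ n → Uniqueₛ.Unique (graphSetoid n) (allGraphs n)
allGraphs-unique zero    = [] ∷ []
allGraphs-unique (suc n) =
  Uniqueₛₚ.cartesianProductWith⁺ (setoid _) (graphSetoid n) (graphSetoid (suc n)) extend
    (λ eq → lookup-injective (λ i → eq zero (suc i)) , λ i j → eq (suc i) (suc j))
    (bitVectors-unique n) (allGraphs-unique n)
  where
  lookup-injective : ∀ {m} {u v : Vec Bool m} → (∀ i → lookup u i ≡ lookup v i) → u ≡ v
  lookup-injective {u = u} {v} eq =
    trans (sym (Vec.tabulate∘lookup u)) (trans (Vec.tabulate-cong eq) (Vec.tabulate∘lookup v))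

allGraphs-nonZero : ∀ n → NonZero (length (allGraphs n))
allGraphs-nonZero n = nonEmpty (allGraphs-complete edgeless)
  where
  edgeless : Graph n
  edgeless = record { adj = λ _ _ → false ; adj-sym = λ _ _ → refl ; adj-irrefl = λ _ → refl }

  nonEmpty : ∀ {A : Set} {P : Pred A 0ℓ} {xs} → Any P xs → NonZero (length xs)
  nonEmpty (here _)  = _
  nonEmpty (there _) = _

Pr : ∀ {n} {A : Pred (Graph n) 0ℓ} → Decidable A → ℚᵘ
Pr {n} A? = + length (filter A? (allGraphs n)) ℚ./ length (allGraphs n)
  where instance
    _ : NonZero (length (allGraphs n))
    _ = allGraphs-nonZero n

infix 4 _⟶_

_⟶_ : (ℕ → ℚᵘ) → ℚᵘ → Set
f ⟶ c = ∀ ε → 0ℚᵘ ℚ.< ε → ∃[ N ] (∀ n → N ℕ.≤ n → ℚ.∣ f n ℚ.- c ∣ ℚ.< ε)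

-- A probability by counting is only available for decidable events, and the
-- events of interest compare real numbers.  So the probability of E tending
-- to 1 means that E contains decidable events whose probability tends to 1;
-- if E is itself decidable, this is just Pr E ⟶ 1.
AlmostAll : (∀ {n} → Pred (Graph n) 0ℓ) → Set₁
AlmostAll E =
  Σ[ A ∈ (∀ n → Pred (Graph n) 0ℓ) ] Σ[ A? ∈ (∀ n → Decidable (A n)) ]
    ((∀ n → A n ⊆ E) × ((λ n → Pr (A? n)) ⟶ 1ℚᵘ))

-- Extended real numbers as two-sided (open) Dedekind cuts.  Only the two
-- predicates are recorded; the operations below preserve the cut axioms,
-- except that ∞ - ∞ is not a cut.

record Cut : Set₁ where
  field
    lower upper : Pred ℚᵘ 0ℓ

open Cut public

fromℕ : ℕ → Cut
fromℕ n .lower q = q ℚ.< + n ℚ./ 1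
fromℕ n .upper q = + n ℚ./ 1 ℚ.< q

infixl 6 _+_ _-_
infix  8 -_
infixl 7 2·_
infix  4 _≤_ _≥_

_+_ : Cut → Cut → Cut
(x + y) .lower q = ∃[ r ] ∃[ s ] (lower x r × lower y s × q ℚ.≤ r ℚ.+ s)
(x + y) .upper q = ∃[ r ] ∃[ s ] (upper x r × upper y s × r ℚ.+ s ℚ.≤ q)

-_ : Cut → Cut
(- x) .lower q = upper x (ℚ.- q)
(- x) .upper q = lower x (ℚ.- q)

_-_ : Cut → Cut → Cut
x - y = x + (- y)

2·_ : Cut → Cut
2· x = x + x

_≤_ : Cut → Cut → Set
x ≤ y = lower x ⊆ lower y

_≥_ : Cut → Cut → Set
x ≥ y = y ≤ x

infixr 8 _^_

_^_ : ℚᵘ → ℕ → ℚᵘ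
q ^ zero  = 1ℚᵘ
q ^ suc k = q ℚ.* q ^ k

pow2 : ℤ → ℚᵘ
pow2 (+ k)    = (+ 2 ℚ./ 1) ^ k
pow2 -[1+ k ] = (+ 1 ℚ./ 2) ^ suc k

-- For q = a/b we have q < log₂ x iff 2^(a/b) < r for some rational r < x,
-- and 2^(a/b) < r iff r > 0 and 2^a < r^b; similarly for log₂ x < q.
-- If x ≤ 0, then log₂ x = -∞.
log₂ : Cut → Cut
log₂ x .lower q = ∃[ r ] (lower x r × 0ℚᵘ ℚ.< r × pow2 (↥ q) ℚ.< r ^ ↧ₙ q)
log₂ x .upper q = ∃[ r ] (upper x r × 0ℚᵘ ℚ.< r × r ^ ↧ₙ q ℚ.< pow2 (↥ q))

{-# OPTIONS --safe #-}

-- If ℓ(G) < n - s and r = s + 1, then the word of a letter graph isomorphic to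
-- G has r positions whose letter also occurs at another, representative
-- position.  Completing the representatives to exactly r gives 2r vertices
-- which induce an r-letter graph whose word has r new and r repeated letters.
-- Naming the new letters in order of appearance leaves at most 4^r r^r words
-- (rather than r^(2r)); with n^(2r) choices of the vertices and 2^(r²)
-- decoders, there are few possibilities compared with the 2^(r(2r-1)) graphs on
-- these vertices, so a proportion of at most n^(2r) 4^r r^r / 2^(rs) of all
-- graphs is bad.  For s ≈ 2 log₂ n + 2 log₂ log₂ n and large n this is below 2^(-r).

module Submission where

open import Defs

open import Data.Bool.Base using (Bool; true; false)
open import Data.Fin.Base as Fin using (Fin; zero; suc)
open import Data.Fin.Permutation using (_⟨$⟩ʳ_; _⟨$⟩ˡ_; inverseʳ)
import Data.Fin.Properties as Fin
open import Data.Integer.Base as ℤ using (ℤ; +_; -[1+_])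
import Data.Integer.Properties as ℤ
import Data.Integer.Tactic.RingSolver as ℤSolver
open import Data.List.Base as List
  using (List; []; _∷_; _++_; allFin; cartesianProduct; cartesianProductWith; filter; length; map; tabulate)
import Data.List.Membership.DecPropositional as DecMembership
open import Data.List.Membership.Propositional using (_∈_)
open import Data.List.Membership.Propositional.Properties
  using (∈-allFin; ∈-cartesianProduct⁺; ∈-cartesianProductWith⁺; ∈-filter⁺; ∈-lookup; ∈-map⁺; ∈-++⁺ˡ; ∈-++⁺ʳ; ∈-length)
import Data.List.Membership.Setoid as Membership
import Data.List.Membership.Setoid.Properties as Membershipₚ
open import Data.List.Properties
  using (filter-notAll; length-++; length-map; length-tabulate; map-tabulate; tabulate-lookup)
open import Data.List.Relation.Binary.Sublist.Propositional using (_⊆_; []; _∷_; _∷ʳ_; ⊆-refl)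
open import Data.List.Relation.Ternary.Interleaving.Propositional
  using (Interleaving; []; consˡ; consʳ)
open import Data.List.Relation.Unary.All as All using (All; []; _∷_)
open import Data.List.Relation.Unary.All.Properties using (¬Any⇒All¬; all-filter; cartesianProduct⁺)
open import Data.List.Relation.Unary.AllPairs using ([]; _∷_)
open import Data.List.Relation.Unary.Any as Any using (here; there; index)
open import Data.List.Relation.Unary.Any.Properties using (lookup-index)
open import Data.List.Relation.Unary.Unique.Propositional using (Unique)
import Data.List.Relation.Unary.Unique.Setoid as Uniqueₛ
import Data.List.Relation.Unary.Unique.Setoid.Properties as Uniqueₛₚ
open import Data.Maybe.Base using (Maybe; just; nothing)
open import Data.Nat.Base as ℕ using (ℕ; zero; suc; z≤n; s≤s; NonZero; ⌊_/2⌋)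
open import Data.Nat.Induction using (<-rec)
open import Data.Nat.Logarithm
  using (⌊log₂_⌋; ⌊log₂⌋-mono-≤; ⌊log₂⌊n/2⌋⌋≡⌊log₂n⌋∸1; ⌊log₂[2^n]⌋≡n)
import Data.Nat.Properties as ℕ
open import Data.Nat.Tactic.RingSolver using (solve-∀)
open import Data.Product.Base using (Σ-syntax; ∃-syntax; _×_; _,_; proj₁; proj₂; uncurry)
open import Data.Product.Relation.Binary.Pointwise.NonDependent using (_×ₛ_)
open import Data.Rational.Unnormalised.Base as ℚ
  using (ℚᵘ; mkℚᵘ; 0ℚᵘ; 1ℚᵘ; ↥_; ↧ₙ_; *≤*; *<*; *≡*)
import Data.Rational.Unnormalised.Properties as ℚ
open import Data.Sum.Base using (_⊎_; inj₁; inj₂)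
open import Data.Vec.Base as Vec using (Vec; []; _∷_; lookup)
open import Data.Vec.Properties using (lookup∘tabulate)
open import Function.Base using (_∘_; case_of_; id)
open import Level using (Level; 0ℓ)
open import Relation.Binary.Bundles using (Setoid)
open import Relation.Binary.Definitions using (tri<; tri≈; tri>)
open import Relation.Binary.PropositionalEquality
  using (_≡_; refl; sym; trans; cong; cong₂; subst; subst₂; setoid; module ≡-Reasoning)
open import Relation.Nullary using (yes; no; ¬?; ¬_; contradiction; _×-dec_)
open import Relation.Unary using (Pred; Decidable)

private
  variable
    A L : Set

-- Counting with duplicate-free lists.

length-cartesianProductWith : ∀ {B C : Set} (f : A → B → C) xs ys →
  length (cartesianProductWith f xs ys) ≡ length xs ℕ.* length ys
length-cartesianProductWith f []       ys = refl
length-cartesianProductWith f (x ∷ xs) ys = trans (length-++ (map (f x) ys))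
  (cong₂ ℕ._+_ (length-map (f x) ys) (length-cartesianProductWith f xs ys))

module _ {c ℓ′ : Level} (S : Setoid c ℓ′) where
  open Setoid S using (_≈_) renaming (sym to ≈-sym)
  open Membership S renaming (_∈_ to _∈ₛ_)

  private
    unique⇒lookup-injective : ∀ {xs} → Uniqueₛ.Unique S xs → ∀ i j →
                              List.lookup xs i ≈ List.lookup xs j → i ≡ j
    unique⇒lookup-injective (x∉xs ∷ xs!) zero    zero    eq = refl
    unique⇒lookup-injective (x∉xs ∷ xs!) zero    (suc j) eq =
      contradiction eq (All.lookup x∉xs (∈-lookup j))
    unique⇒lookup-injective (x∉xs ∷ xs!) (suc i) zero    eq =
      contradiction (≈-sym eq) (All.lookup x∉xs (∈-lookup i))
    unique⇒lookup-injective (x∉xs ∷ xs!) (suc i) (suc j) eq =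
      cong suc (unique⇒lookup-injective xs! i j eq)

  -- Each entry of `xs` goes to the position of its membership witness in `ys`. Entries with the
  -- same position are equivalent, so they occupy the same place of `xs`. Graphs are counted up to
  -- `≈ᴳ`, hence the setoid.
  unique⇒length-≤ : ∀ {xs ys} → Uniqueₛ.Unique S xs → All (_∈ₛ ys) xs → length xs ℕ.≤ length ys
  unique⇒length-≤ {xs} xs! xs⊆ys = Fin.injective⇒≤ λ {i} {j} eq →
    unique⇒lookup-injective xs! i j
      (Membershipₚ.index-injective S (All.lookup xs⊆ys (∈-lookup i)) (All.lookup xs⊆ys (∈-lookup j)) eq)

unique⇒length-≤-Fin : ∀ {k} {xs : List (Fin k)} → Unique xs → length xs ℕ.≤ k
unique⇒length-≤-Fin {k} xs! =
  ℕ.≤-trans (unique⇒length-≤ (setoid _) xs! (All.tabulate λ _ → ∈-allFin _))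
    (ℕ.≤-reflexive (length-tabulate {n = k} _))

-- Words with letters introduced in a fixed order.

vectors : List A → ∀ m → List (Vec A m)
vectors alphabet zero    = [] ∷ []
vectors alphabet (suc m) = cartesianProductWith _∷_ alphabet (vectors alphabet m)

length-vectors : ∀ (alphabet : List A) m → length (vectors alphabet m) ≡ length alphabet ℕ.^ m
length-vectors alphabet zero    = refl
length-vectors alphabet (suc m) = trans (length-cartesianProductWith _∷_ alphabet (vectors alphabet m))
  (cong (length alphabet ℕ.*_) (length-vectors alphabet m))

vectors-complete : ∀ {alphabet : List A} → (∀ x → x ∈ alphabet) → ∀ {m} (u : Vec A m) →
                   u ∈ vectors alphabet m
vectors-complete ∈alphabet []      = here refl
vectors-complete ∈alphabet (x ∷ u) =
  ∈-cartesianProductWith⁺ _∷_ (∈alphabet x) (vectors-complete ∈alphabet u)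

-- The words of length m in which the letters in names are introduced in this
-- order, while every other position repeats an arbitrary letter.
words : List A → List A → ∀ m → List (Vec A m)
words alphabet []          m       = vectors alphabet m
words alphabet (_ ∷ _)     zero    = []
words alphabet (x ∷ names) (suc m) =
  map (x ∷_) (words alphabet names m) ++
  cartesianProductWith _∷_ alphabet (words alphabet (x ∷ names) m)

-- The factor `2 ^ m` pays for the choice of the introducing positions; these leave no choice of
-- letter, which saves `length names` powers of the alphabet size. The saving stands on the left to
-- avoid division.
length-words : ∀ (alphabet names : List A) m →
  length (words alphabet names m) ℕ.* length alphabet ℕ.^ length names
    ℕ.≤ 2 ℕ.^ m ℕ.* length alphabet ℕ.^ m
length-words alphabet []          m       = begin
  length (vectors alphabet m) ℕ.* 1 ≡⟨ ℕ.*-identityʳ _ ⟩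
  length (vectors alphabet m)       ≡⟨ length-vectors alphabet m ⟩
  length alphabet ℕ.^ m             ≤⟨ ℕ.m≤n*m _ (2 ℕ.^ m) {{ℕ.m^n≢0 2 m}} ⟩
  2 ℕ.^ m ℕ.* length alphabet ℕ.^ m ∎
  where open ℕ.≤-Reasoning
length-words alphabet (_ ∷ _)     zero    = z≤n
length-words alphabet (x ∷ names) (suc m) = begin
  length (map (x Vec.∷_) V ++ cartesianProductWith Vec._∷_ alphabet W) ℕ.* (k ℕ.* K)
    ≡⟨ cong (ℕ._* (k ℕ.* K)) (trans (length-++ (map (x Vec.∷_) V))
         (cong₂ ℕ._+_ (length-map _ V) (length-cartesianProductWith _∷_ alphabet W))) ⟩
  (length V ℕ.+ k ℕ.* length W) ℕ.* (k ℕ.* K)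
    ≡⟨ rearrange (length V) (length W) k K ⟩
  k ℕ.* (length V ℕ.* K) ℕ.+ k ℕ.* (length W ℕ.* (k ℕ.* K))
    ≤⟨ ℕ.+-mono-≤ (ℕ.*-monoʳ-≤ k (length-words alphabet names m))
         (ℕ.*-monoʳ-≤ k (length-words alphabet (x ∷ names) m)) ⟩
  k ℕ.* (2 ℕ.^ m ℕ.* k ℕ.^ m) ℕ.+ k ℕ.* (2 ℕ.^ m ℕ.* k ℕ.^ m)
    ≡⟨ double k (2 ℕ.^ m) (k ℕ.^ m) ⟩
  2 ℕ.* 2 ℕ.^ m ℕ.* (k ℕ.* k ℕ.^ m) ∎
  where
  open ℕ.≤-Reasoning
  k = length alphabet
  K = k ℕ.^ length names
  V = words alphabet names m
  W = words alphabet (x ∷ names) m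
  rearrange : ∀ v w k K → (v ℕ.+ k ℕ.* w) ℕ.* (k ℕ.* K) ≡ k ℕ.* (v ℕ.* K) ℕ.+ k ℕ.* (w ℕ.* (k ℕ.* K))
  rearrange = solve-∀
  double : ∀ k P Q → k ℕ.* (P ℕ.* Q) ℕ.+ k ℕ.* (P ℕ.* Q) ≡ 2 ℕ.* P ℕ.* (k ℕ.* Q)
  double = solve-∀

-- `Fin r` is an alphabet of names that `v` translates into letters; two names may share a letter.
-- The chosen positions induce a letter graph over `Fin r`, with the decoder of `w` pulled back
-- along `v`.
record Subword {n r} (w : Fin n → L) (v : Fin r → L) (names : List (Fin r)) (m : ℕ) : Set where
  field
    word       : Vec (Fin r) m
    word∈words : word ∈ words (allFin r) names m
    position   : Fin m → Fin n
    increasing : ∀ {p q} → p Fin.< q → position p Fin.< position q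
    spells     : ∀ p → v (lookup word p) ≡ w (position p)

open Subword

subword-skip : ∀ {n r m} {w : Fin (suc n) → L} {v : Fin r → L} {names} →
               Subword (w ∘ suc) v names m → Subword w v names m
subword-skip s .word           = s .word
subword-skip s .word∈words     = s .word∈words
subword-skip s .position       = suc ∘ s .position
subword-skip s .increasing p<q = s≤s (s .increasing p<q)
subword-skip s .spells         = s .spells

subword-cons : ∀ {n r m} {w : Fin (suc n) → L} {v : Fin r → L} {names names′} x → v x ≡ w zero →
               (∀ {u} → u ∈ words (allFin r) names m → x ∷ u ∈ words (allFin r) names′ (suc m)) →
               Subword (w ∘ suc) v names m → Subword w v names′ (suc m)
subword-cons x eq grow s .word             = x ∷ s .word
subword-cons x eq grow s .word∈words       = grow (s .word∈words)
subword-cons x eq grow s .position zero    = zero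
subword-cons x eq grow s .position (suc p) = suc (s .position p)
subword-cons x eq grow s .increasing {zero}  {suc q} _         = s≤s z≤n
subword-cons x eq grow s .increasing {suc p} {suc q} (s≤s p<q) = s≤s (s .increasing p<q)
subword-cons x eq grow s .spells zero      = eq
subword-cons x eq grow s .spells (suc p)   = s .spells p

∈-words-old : ∀ {alphabet : List A} {x m} → x ∈ alphabet → ∀ names {u} →
              u ∈ words alphabet names m → x ∷ u ∈ words alphabet names (suc m)
∈-words-old x∈ []          u∈ = ∈-cartesianProductWith⁺ _∷_ x∈ u∈
∈-words-old x∈ (y ∷ names) u∈ = ∈-++⁺ʳ (map (y ∷_) (words _ names _)) (∈-cartesianProductWith⁺ _∷_ x∈ u∈)

-- Walk along `w`, keeping every old entry under some name that translates to it. A new entry is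
-- kept, introducing the next name, exactly when the sublist embedding selects it. The equation for
-- `m` lets each kept position simply turn `m` into `suc m`.
interleaving⇒subword : ∀ {n r} (w : Fin n → L) (v : Fin r → L) {news olds} names →
  Interleaving news olds (tabulate w) → map v names ⊆ news →
  All (λ o → ∃[ x ] v x ≡ o) olds →
  ∃[ m ] (m ≡ length names ℕ.+ length olds × Subword w v names m)
interleaving⇒subword {n = zero} w v [] [] [] [] = 0 , refl ,
  record { word = [] ; word∈words = here refl ; position = λ () ; increasing = λ { {()} } ; spells = λ () }
interleaving⇒subword {n = suc n} w v [] (consˡ i) (_ ∷ʳ ⊆news) olds =
  let m , eq , s = interleaving⇒subword (w ∘ suc) v [] i ⊆news olds in
  m , eq , subword-skip s
interleaving⇒subword {n = suc n} w v names@(_ ∷ _) (consˡ i) (_ ∷ʳ ⊆news) olds =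
  let m , eq , s = interleaving⇒subword (w ∘ suc) v names i ⊆news olds in
  m , eq , subword-skip s
interleaving⇒subword {n = suc n} w v (x ∷ names) (consˡ i) (vx≡ ∷ ⊆news) olds =
  let m , eq , s = interleaving⇒subword (w ∘ suc) v names i ⊆news olds in
  suc m , cong suc eq , subword-cons x vx≡ (λ u∈ → ∈-++⁺ˡ (∈-map⁺ (x ∷_) u∈)) s
interleaving⇒subword {n = suc n} w v names (consʳ i) ⊆news ((x , vx≡) ∷ olds) =
  let m , eq , s = interleaving⇒subword (w ∘ suc) v names i ⊆news olds in
  suc m , trans (cong suc eq) (sym (ℕ.+-suc (length names) _)) ,
  subword-cons x vx≡ (∈-words-old (∈-allFin x) names) s

-- Finding repetitions in a word.

module _ {k : ℕ} where
  open DecMembership (Fin._≟_ {k}) using (_∈?_)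

  -- Scanning from the right, a letter seen before is put aside as a
  -- repetition until r repetitions are found.
  repetitions : ∀ {n} r (w : Fin n → Fin k) → ∃[ news ] ∃[ olds ]
    (Interleaving news olds (tabulate w) × All (_∈ news) olds ×
     length news ℕ.+ length olds ≡ n × length olds ℕ.≤ r ×
     (length olds ≡ r ⊎ Unique news))
  repetitions {zero} r w = [] , [] , [] , [] , refl , z≤n , inj₂ []
  repetitions {suc n} r w with repetitions r (w ∘ suc)
  ... | news , olds , i , olds⊆ , eq , ≤r , inj₁ full =
    w zero ∷ news , olds , consˡ i , All.map there olds⊆ , cong suc eq , ≤r , inj₁ full
  ... | news , olds , i , olds⊆ , eq , ≤r , inj₂ news! with w zero ∈? news
  ...   | no ∉news =
    w zero ∷ news , olds , consˡ i , All.map there olds⊆ , cong suc eq , ≤r ,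
    inj₂ (¬Any⇒All¬ _ ∉news ∷ news!)
  ...   | yes ∈news with length olds ℕ.≟ r
  ...     | yes full =
    w zero ∷ news , olds , consˡ i , All.map there olds⊆ , cong suc eq , ≤r , inj₁ full
  ...     | no ¬full =
    news , w zero ∷ olds , consʳ i , ∈news ∷ olds⊆ ,
    trans (ℕ.+-suc _ _) (cong suc eq) , ℕ.≤∧≢⇒< ≤r ¬full , inj₂ news!

  -- Greedy choice from the left: a letter that `os` still demands is taken, any other is skipped
  -- while enough entries remain. The open demands never outnumber the places left.
  covering-sublist : ∀ t (xs os : List (Fin k)) → length os ℕ.≤ t → t ℕ.≤ length xs →
    ∃[ ys ] (ys ⊆ xs × length ys ≡ t × (∀ {o} → o ∈ os → o ∈ xs → o ∈ ys))
  covering-sublist zero [] os os≤t t≤xs = [] , [] , refl , λ _ o∈ → o∈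
  covering-sublist t (x ∷ xs) os os≤t t≤xs with x ∈? os
  covering-sublist t (x ∷ xs) os os≤t t≤xs | no x∉os with t ℕ.≟ suc (length xs)
  ... | yes refl = x ∷ xs , ⊆-refl , refl , λ _ o∈ → o∈
  ... | no t≢ =
    let ys , ys⊆ , eq , cov = covering-sublist t xs os os≤t (ℕ.≤-pred (ℕ.≤∧≢⇒< t≤xs t≢)) in
    ys , x ∷ʳ ys⊆ , eq ,
    λ { o∈ (here refl) → contradiction o∈ x∉os ; o∈ (there o∈xs) → cov o∈ o∈xs }
  covering-sublist zero (x ∷ xs) os os≤t t≤xs | yes x∈os =
    contradiction (∈-length x∈os) (ℕ.≤⇒≯ os≤t)
  covering-sublist (suc t) (x ∷ xs) os os≤t (s≤s t≤xs) | yes x∈os =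
    -- The chosen `x` serves all its copies in `os`. At least one is removed, so the demand drops
    -- along with `suc t`.
    let ≢x? = λ o → ¬? (x Fin.≟ o)
        shorter = filter-notAll ≢x? os (Any.map (λ x≡o x≢o → x≢o x≡o) x∈os)
        ys , ys⊆ , eq , cov =
          covering-sublist t xs (filter ≢x? os) (ℕ.≤-pred (ℕ.≤-trans shorter os≤t)) t≤xs in
    x ∷ ys , refl ∷ ys⊆ , cong suc eq , λ
      { _ (here refl) → here refl
      ; {o} o∈ (there o∈xs) → case x Fin.≟ o of λ
        { (yes refl) → here refl
        ; (no x≢o)   → there (cov (∈-filter⁺ ≢x? o∈ x≢o) o∈xs) } }

  -- Fewer than `r` repetitions would leave `news` free of duplicates, hence of length at most `k`,
  -- contradicting `k + r ≤ n`. Then `r + r ≤ n` leaves at least `r` new entries, enough to choose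
  -- exactly `r` that represent all old letters.
  repetitive-subword : ∀ {n} r (w : Fin n → Fin k) → k ℕ.+ r ℕ.≤ n → r ℕ.+ r ℕ.≤ n →
    Σ[ v ∈ (Fin r → Fin k) ] Subword w v (allFin r) (r ℕ.+ r)
  repetitive-subword {n} r w k+r≤n r+r≤n with repetitions r w
  ... | news , olds , i , olds⊆ , eq , ≤r , full-or-unique =
    let ys , ys⊆ , |ys|≡r , cov = covering-sublist r news olds ≤r r≤news in conclude ys ys⊆ |ys|≡r cov
    where
    open ℕ.≤-Reasoning

    full : length olds ≡ r
    full = case full-or-unique of λ where
      (inj₁ |olds|≡r) → |olds|≡r
      (inj₂ news!)    → ℕ.≤-antisym ≤r (ℕ.+-cancelˡ-≤ k _ _ (begin
        k ℕ.+ r                      ≤⟨ k+r≤n ⟩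
        n                            ≡⟨ sym eq ⟩
        length news ℕ.+ length olds  ≤⟨ ℕ.+-monoˡ-≤ _ (unique⇒length-≤-Fin news!) ⟩
        k ℕ.+ length olds            ∎))

    r≤news : r ℕ.≤ length news
    r≤news = ℕ.+-cancelʳ-≤ r _ _ (begin
      r ℕ.+ r                      ≤⟨ r+r≤n ⟩
      n                            ≡⟨ sym eq ⟩
      length news ℕ.+ length olds  ≡⟨ cong (length news ℕ.+_) full ⟩
      length news ℕ.+ r            ∎)

    conclude : ∀ ys → ys ⊆ news → length ys ≡ r → (∀ {o} → o ∈ olds → o ∈ news → o ∈ ys) →
               Σ[ v ∈ (Fin r → Fin k) ] Subword w v (allFin r) (r ℕ.+ r)
    conclude ys ys⊆ refl cov =
      -- The names number the entries of `ys` in their order in `w`, so translating all of them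
      -- gives back `ys`.
      let m , m≡ , s = interleaving⇒subword w (List.lookup ys) (allFin r) i
            (subst (_⊆ news) (sym (trans (map-tabulate id (List.lookup ys)) (tabulate-lookup ys))) ys⊆)
            (All.tabulate λ o∈ → let o∈ys = cov o∈ (All.lookup olds⊆ o∈) in
              index o∈ys , sym (lookup-index o∈ys))
      in List.lookup ys , subst (Subword w _ (allFin r))
           (trans m≡ (cong₂ ℕ._+_ (length-tabulate {n = r} id) full)) s

-- Counting graphs of small lettericity

letterAdj-pullback : ∀ {k l m n} (D : Decoder k) (E : Decoder l) (w : Word k n) (u : Word l m)
  (z : Fin m → Fin n) → (∀ {p q} → p Fin.< q → z p Fin.< z q) →
  (∀ p q → E (u p) (u q) ≡ D (w (z p)) (w (z q))) →
  ∀ p q → letterAdj E u p q ≡ letterAdj D w (z p) (z q)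
letterAdj-pullback D E w u z incr eq p q with Fin.<-cmp p q | Fin.<-cmp (z p) (z q)
... | tri< _   _    _   | tri< _ _ _        = eq p q
... | tri< p<q _    _   | tri≈ ¬z< _ _      = contradiction (incr p<q) ¬z<
... | tri< p<q _    _   | tri> ¬z< _ _      = contradiction (incr p<q) ¬z<
... | tri≈ _   refl _   | tri< _ z≢ _       = contradiction refl z≢
... | tri≈ _   _    _   | tri≈ _ _ _        = refl
... | tri≈ _   refl _   | tri> _ z≢ _       = contradiction refl z≢
... | tri> _   _    q<p | tri< _ _ ¬z>      = contradiction (incr q<p) ¬z>
... | tri> _   _    q<p | tri≈ _ _ ¬z>      = contradiction (incr q<p) ¬z>
... | tri> _   _    _   | tri> _ _ _        = eq q p

increasing⇒injective : ∀ {m n} {z : Fin m → Fin n} → (∀ {p q} → p Fin.< q → z p Fin.< z q) →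
                       ∀ {p q} → z p ≡ z q → p ≡ q
increasing⇒injective incr {p} {q} eq with Fin.<-cmp p q
... | tri< p<q _ _ = contradiction eq (Fin.<⇒≢ (incr p<q))
... | tri≈ _ p≡q _ = p≡q
... | tri> _ _ q<p = contradiction (sym eq) (Fin.<⇒≢ (incr q<p))

pullback : ∀ {m n} → (Fin m → Fin n) → Graph n → Graph m
pullback z G .adj p q      = adj G (z p) (z q)
pullback z G .adj-sym p q  = adj-sym G (z p) (z q)
pullback z G .adj-irrefl p = adj-irrefl G (z p)

module _ {m n} (z : Fin m → Fin n) where

  preimage : Fin n → Maybe (Fin m)
  preimage i with Fin.any? (λ p → z p Fin.≟ i)
  ... | yes (p , _) = just p
  ... | no _        = nothing

  preimage-sound : ∀ i {p} → preimage i ≡ just p → z p ≡ i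
  preimage-sound i eq with Fin.any? (λ p → z p Fin.≟ i)
  preimage-sound i refl | yes (_ , eq) = eq

  preimage-image : (∀ {p q} → z p ≡ z q → p ≡ q) → ∀ p → preimage (z p) ≡ just p
  preimage-image inj p with Fin.any? (λ q → z q Fin.≟ z p)
  ... | yes (q , eq) = cong just (inj eq)
  ... | no ∄q        = contradiction (p , refl) ∄q

private
  merge : ∀ {m} → Graph m → Bool → Maybe (Fin m) → Maybe (Fin m) → Bool
  merge H b (just p) (just q) = adj H p q
  merge H b _        _        = b

  merge-sym : ∀ {m} (H : Graph m) {b c} → b ≡ c → ∀ p q → merge H b p q ≡ merge H c q p
  merge-sym H b≡c (just p) (just q) = adj-sym H p q
  merge-sym H b≡c (just _) nothing  = b≡c
  merge-sym H b≡c nothing  (just _) = b≡c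
  merge-sym H b≡c nothing  nothing  = b≡c

  merge-irrefl : ∀ {m} (H : Graph m) {b} → b ≡ false → ∀ p → merge H b p p ≡ false
  merge-irrefl H b≡ (just p) = adj-irrefl H p
  merge-irrefl H b≡ nothing  = b≡

overlay : ∀ {m n} → (Fin m → Fin n) → Graph m → Graph n → Graph n
overlay z H G .adj i j      = merge H (adj G i j) (preimage z i) (preimage z j)
overlay z H G .adj-sym i j  = merge-sym H (adj-sym G i j) (preimage z i) (preimage z j)
overlay z H G .adj-irrefl i = merge-irrefl H (adj-irrefl G i) (preimage z i)

module _ {m n} (z : Fin m → Fin n) where

  overlay-cong : ∀ H {G G′} → G ≈ᴳ G′ → overlay z H G ≈ᴳ overlay z H G′
  overlay-cong H G≈G′ i j with preimage z i | preimage z j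
  ... | just _  | just _  = refl
  ... | just _  | nothing = G≈G′ i j
  ... | nothing | _       = G≈G′ i j

  pullback-overlay : (∀ {p q} → z p ≡ z q → p ≡ q) → ∀ H G → pullback z (overlay z H G) ≈ᴳ H
  pullback-overlay inj H G p q =
    cong₂ (merge H _) (preimage-image z inj p) (preimage-image z inj q)

  -- The inner overlay changes only edges inside the image of `z`, and writing a copy of the induced
  -- subgraph there restores `G`. The overwritten edges thus have room for an arbitrary `H′`.
  overlay-overlay : ∀ {H} G → H ≈ᴳ pullback z G → ∀ H′ → overlay z H (overlay z H′ G) ≈ᴳ G
  overlay-overlay G H≈ H′ i j
    with preimage z i | preimage-sound z i | preimage z j | preimage-sound z j
  ... | just p  | ≡i | just q  | ≡j = trans (H≈ p q) (cong₂ (adj G) (≡i refl) (≡j refl))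
  ... | just _  | _  | nothing | _  = refl
  ... | nothing | _  | _       | _  = refl

decoder : ∀ {r} → Vec Bool (r ℕ.* r) → Decoder r
decoder bits x y = lookup bits (Fin.combine x y)

decoder-surjective : ∀ {r} (D : Decoder r) → ∃[ bits ] (∀ x y → decoder bits x y ≡ D x y)
decoder-surjective {r} D = Vec.tabulate (uncurry D ∘ Fin.remQuot r) , λ x y →
  trans (lookup∘tabulate _ (Fin.combine x y)) (cong (uncurry D) (Fin.remQuot-combine x y))

Repetitive : ∀ {n} → ℕ → Graph n → Set
Repetitive {n} r G = ∃[ k ] (k ℕ.+ r ℕ.≤ n × IsLetterGraph k G)

module _ (n r : ℕ) where

  private
    m = r ℕ.+ r

    PairSetoid : Setoid 0ℓ 0ℓ
    PairSetoid = graphSetoid n ×ₛ graphSetoid m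

    open Membership PairSetoid renaming (_∈_ to _∈ₛ_)

  Code : Set
  Code = Vec (Fin n) m × Vec (Fin r) m × Vec Bool (r ℕ.* r)

  codes : List Code
  codes = cartesianProduct (vectors (allFin n) m)
            (cartesianProduct (words (allFin r) (allFin r) m) (bitVectors (r ℕ.* r)))

  -- A pair (G , H) is stored as a single graph on n vertices: H replaces the
  -- subgraph of G induced by z, which is recovered from the word and the bits.
  decode : Code → Graph n → Graph n × Graph m
  decode (z , u , bits) G =
    overlay (lookup z) (Γ (decoder bits) (lookup u)) G , pullback (lookup z) G

  -- The positions of a repetitive subword, moved into `G` by the inverse isomorphism, give `z`; the
  -- pulled-back decoder gives the bits. Word and bits determine the subgraph induced by `z`, so `H`
  -- can be stored in its place.
  decode-complete : m ℕ.≤ n → ∀ {G} → Repetitive r G → ∀ H →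
                    (G , H) ∈ₛ cartesianProductWith decode codes (allGraphs n)
  decode-complete m≤n {G} (k , k+r≤n , D , w , π , iso) H =
    Membershipₚ.∈-resp-≈ PairSetoid {x = decode code G′} {y = G , H}
      (overlay-overlay (lookup z) G Γ≈ H , pullback-overlay (lookup z) z-injective H G)
      (Membershipₚ.∈-cartesianProductWith⁺ (setoid _) (graphSetoid n) PairSetoid {f = decode}
        (λ { {x = z , u , bits} {u = G₁} {v = G₂} refl G≈ →
             overlay-cong (lookup z) (Γ (decoder bits) (lookup u)) {G₁} {G₂} G≈ ,
             λ p q → G≈ (lookup z p) (lookup z q) })
        {a = code} {b = G′}
        (∈-cartesianProduct⁺ (vectors-complete ∈-allFin z)
          (∈-cartesianProduct⁺ (word∈words s) (bitVectors-complete bits)))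
        (allGraphs-complete G′))
    where
    open ≡-Reasoning
    v = proj₁ (repetitive-subword r w k+r≤n m≤n)
    s = proj₂ (repetitive-subword r w k+r≤n m≤n)

    z : Vec (Fin n) m
    z = Vec.tabulate λ p → π ⟨$⟩ˡ position s p

    E : Decoder r
    E x y = D (v x) (v y)

    bits = proj₁ (decoder-surjective E)
    decoder≗E = proj₂ (decoder-surjective E)

    code : Code
    code = z , word s , bits

    G′ : Graph n
    G′ = overlay (lookup z) H G

    π-z : ∀ p → π ⟨$⟩ʳ lookup z p ≡ position s p
    π-z p = trans (cong (π ⟨$⟩ʳ_) (lookup∘tabulate _ p)) (inverseʳ π)

    z-injective : ∀ {p q} → lookup z p ≡ lookup z q → p ≡ q
    z-injective {p} {q} eq = increasing⇒injective (increasing s)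
      (trans (sym (π-z p)) (trans (cong (π ⟨$⟩ʳ_) eq) (π-z q)))

    Γ≈ : Γ (decoder bits) (lookup (word s)) ≈ᴳ pullback (lookup z) G
    Γ≈ p q = begin
      letterAdj (decoder bits) (lookup (word s)) p q
        ≡⟨ letterAdj-pullback D (decoder bits) w (lookup (word s)) (position s) (increasing s)
             (λ p q → trans (decoder≗E _ _) (cong₂ D (spells s p) (spells s q))) p q ⟩
      letterAdj D w (position s p) (position s q)
        ≡⟨ sym (cong₂ (letterAdj D w) (π-z p) (π-z q)) ⟩
      letterAdj D w (π ⟨$⟩ʳ lookup z p) (π ⟨$⟩ʳ lookup z q)
        ≡⟨ iso (lookup z p) (lookup z q) ⟩
      adj G (lookup z p) (lookup z q) ∎

  module _ {P : Pred (Graph n) 0ℓ} (P? : Decidable P) where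

    -- All pairs of a graph satisfying `P` and an arbitrary graph on `m` vertices are distinct and
    -- occur among the decodings. So the proportion of bad graphs is at most `length codes` over
    -- `length (allGraphs m)`.
    count-repetitive : m ℕ.≤ n → (∀ {G} → P G → Repetitive r G) →
      length (filter P? (allGraphs n)) ℕ.* length (allGraphs m)
        ℕ.≤ length codes ℕ.* length (allGraphs n)
    count-repetitive m≤n P⇒ = begin
      length bad ℕ.* length (allGraphs m)
        ≡⟨ sym (length-cartesianProductWith _,_ bad (allGraphs m)) ⟩
      length (cartesianProduct bad (allGraphs m))
        ≤⟨ unique⇒length-≤ PairSetoid
             (Uniqueₛₚ.cartesianProduct⁺ (graphSetoid n) (graphSetoid m)
               (Uniqueₛₚ.filter⁺ (graphSetoid n) P? (allGraphs-unique n)) (allGraphs-unique m))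
             (cartesianProduct⁺ (setoid _) (setoid _) bad (allGraphs m) λ {G} {H} G∈ _ →
               decode-complete m≤n {G} (P⇒ (All.lookup (all-filter P? (allGraphs n)) G∈)) H) ⟩
      length (cartesianProductWith decode codes (allGraphs n))
        ≡⟨ length-cartesianProductWith decode codes (allGraphs n) ⟩
      length codes ℕ.* length (allGraphs n) ∎
      where
      open ℕ.≤-Reasoning
      bad = filter P? (allGraphs n)

-- Numbers of graphs and codes.

pairs : ℕ → ℕ
pairs zero    = 0
pairs (suc n) = n ℕ.+ pairs n

length-bitVectors : ∀ n → length (bitVectors n) ≡ 2 ℕ.^ n
length-bitVectors zero    = refl
length-bitVectors (suc n) =
  trans (length-cartesianProductWith Vec._∷_ (true ∷ false ∷ []) (bitVectors n))
    (cong (2 ℕ.*_) (length-bitVectors n))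

length-allGraphs : ∀ n → length (allGraphs n) ≡ 2 ℕ.^ pairs n
length-allGraphs zero    = refl
length-allGraphs (suc n) = begin
  length (allGraphs (suc n))                          ≡⟨ length-cartesianProductWith extend (bitVectors n) (allGraphs n) ⟩
  length (bitVectors n) ℕ.* length (allGraphs n)      ≡⟨ cong₂ ℕ._*_ (length-bitVectors n) (length-allGraphs n) ⟩
  2 ℕ.^ n ℕ.* 2 ℕ.^ pairs n                           ≡⟨ sym (ℕ.^-distribˡ-+-* 2 n (pairs n)) ⟩
  2 ℕ.^ (n ℕ.+ pairs n)                               ∎
  where open ≡-Reasoning

2*pairs : ∀ n → 2 ℕ.* pairs n ℕ.+ n ≡ n ℕ.* n
2*pairs zero    = refl
2*pairs (suc n) = begin
  2 ℕ.* (n ℕ.+ pairs n) ℕ.+ suc n                  ≡⟨ rearrange n (pairs n) ⟩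
  2 ℕ.* n ℕ.+ 1 ℕ.+ (2 ℕ.* pairs n ℕ.+ n)          ≡⟨ cong (2 ℕ.* n ℕ.+ 1 ℕ.+_) (2*pairs n) ⟩
  2 ℕ.* n ℕ.+ 1 ℕ.+ n ℕ.* n                        ≡⟨ square n ⟩
  suc n ℕ.* suc n                                  ∎
  where
  open ≡-Reasoning
  rearrange : ∀ n p → 2 ℕ.* (n ℕ.+ p) ℕ.+ suc n ≡ 2 ℕ.* n ℕ.+ 1 ℕ.+ (2 ℕ.* p ℕ.+ n)
  rearrange = solve-∀
  square : ∀ n → 2 ℕ.* n ℕ.+ 1 ℕ.+ n ℕ.* n ≡ suc n ℕ.* suc n
  square = solve-∀

-- `pairs` is the binomial coefficient n choose 2. The exponent r(2r - 1) is split so that `r * r`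
-- cancels against the decoder bits, leaving `r * s` against the choice of vertices and word.
pairs-double : ∀ s → let r = suc s in pairs (r ℕ.+ r) ≡ r ℕ.* r ℕ.+ r ℕ.* s
pairs-double s = ℕ.*-cancelˡ-≡ _ _ 2 (ℕ.+-cancelʳ-≡ (r ℕ.+ r) _ _
  (trans (2*pairs (r ℕ.+ r)) (expand s)))
  where
  r = suc s
  expand : ∀ s → (suc s ℕ.+ suc s) ℕ.* (suc s ℕ.+ suc s) ≡
                 2 ℕ.* (suc s ℕ.* suc s ℕ.+ suc s ℕ.* s) ℕ.+ (suc s ℕ.+ suc s)
  expand = solve-∀

length-codes : ∀ n r → length (codes n r) ℕ.* r ℕ.^ r ℕ.≤
  n ℕ.^ (r ℕ.+ r) ℕ.* (2 ℕ.^ (r ℕ.+ r) ℕ.* r ℕ.^ (r ℕ.+ r)) ℕ.* 2 ℕ.^ (r ℕ.* r)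
length-codes n r = begin
  length (codes n r) ℕ.* r ℕ.^ r
    ≡⟨ cong (ℕ._* r ℕ.^ r) (trans (length-cartesianProductWith _,_ (vectors (allFin n) m) _)
         (cong₂ ℕ._*_
           (trans (length-vectors (allFin n) m) (cong (ℕ._^ m) (length-allFin n)))
           (trans (length-cartesianProductWith _,_ (words (allFin r) (allFin r) m) _)
             (cong (length W ℕ.*_) (length-bitVectors (r ℕ.* r)))))) ⟩
  n ℕ.^ m ℕ.* (length W ℕ.* 2 ℕ.^ (r ℕ.* r)) ℕ.* r ℕ.^ r
    ≡⟨ rearrange (n ℕ.^ m) (length W) (2 ℕ.^ (r ℕ.* r)) (r ℕ.^ r) ⟩
  n ℕ.^ m ℕ.* (length W ℕ.* r ℕ.^ r) ℕ.* 2 ℕ.^ (r ℕ.* r)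
    ≤⟨ ℕ.*-monoˡ-≤ _ (ℕ.*-monoʳ-≤ (n ℕ.^ m) W≤) ⟩
  n ℕ.^ m ℕ.* (2 ℕ.^ m ℕ.* r ℕ.^ m) ℕ.* 2 ℕ.^ (r ℕ.* r) ∎
  where
  open ℕ.≤-Reasoning
  m = r ℕ.+ r
  W = words (allFin r) (allFin r) m
  length-allFin : ∀ n → length (allFin n) ≡ n
  length-allFin n = length-tabulate {n = n} id
  W≤ : length W ℕ.* r ℕ.^ r ℕ.≤ 2 ℕ.^ m ℕ.* r ℕ.^ m
  W≤ = subst (λ x → length W ℕ.* x ℕ.^ x ℕ.≤ 2 ℕ.^ m ℕ.* x ℕ.^ m) (length-allFin r)
    (length-words (allFin r) (allFin r) m)
  rearrange : ∀ x w t y → x ℕ.* (w ℕ.* t) ℕ.* y ≡ x ℕ.* (w ℕ.* y) ℕ.* t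
  rearrange = solve-∀

module _ {n r a s e : ℕ} (r≡ : r ≡ suc s) (n≤ : n ℕ.≤ 2 ℕ.^ a) (r≤ : r ℕ.≤ 2 ℕ.^ e)
         (big : 1 ℕ.+ (a ℕ.+ a) ℕ.+ 2 ℕ.+ e ℕ.≤ s) where

  -- One of the two factors `r ^ r` in the bound on codes cancels; everything else is bounded by a
  -- power of 2, so that only exponents are compared. The factor `2 ^ r` is the gain that makes the
  -- proportion of bad graphs vanish.
  length-codes-small : length (codes n r) ℕ.* 2 ℕ.^ r ℕ.≤ length (allGraphs (r ℕ.+ r))
  length-codes-small = ℕ.*-cancelʳ-≤ _ _ (r ℕ.^ r) {{ℕ.m^n≢0 r r {{subst NonZero (sym r≡) _}}}} (begin
    length (codes n r) ℕ.* 2 ℕ.^ r ℕ.* r ℕ.^ r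
      ≡⟨ rearrange₁ (length (codes n r)) (2 ℕ.^ r) (r ℕ.^ r) ⟩
    length (codes n r) ℕ.* r ℕ.^ r ℕ.* 2 ℕ.^ r
      ≤⟨ ℕ.*-monoˡ-≤ (2 ℕ.^ r) (length-codes n r) ⟩
    n ℕ.^ m ℕ.* (2 ℕ.^ m ℕ.* r ℕ.^ m) ℕ.* 2 ℕ.^ (r ℕ.* r) ℕ.* 2 ℕ.^ r
      ≡⟨ cong (λ x → n ℕ.^ m ℕ.* (2 ℕ.^ m ℕ.* x) ℕ.* 2 ℕ.^ (r ℕ.* r) ℕ.* 2 ℕ.^ r)
           (ℕ.^-distribˡ-+-* r r r) ⟩
    n ℕ.^ m ℕ.* (2 ℕ.^ m ℕ.* (r ℕ.^ r ℕ.* r ℕ.^ r)) ℕ.* 2 ℕ.^ (r ℕ.* r) ℕ.* 2 ℕ.^ r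
      ≤⟨ ℕ.*-monoˡ-≤ (2 ℕ.^ r) (ℕ.*-monoˡ-≤ (2 ℕ.^ (r ℕ.* r)) (ℕ.*-mono-≤
           (power≤ {y = a} m n≤) (ℕ.*-monoʳ-≤ (2 ℕ.^ m) (ℕ.*-monoˡ-≤ (r ℕ.^ r) (power≤ {y = e} r r≤))))) ⟩
    2 ℕ.^ (a ℕ.* m) ℕ.* (2 ℕ.^ m ℕ.* (2 ℕ.^ (e ℕ.* r) ℕ.* r ℕ.^ r)) ℕ.* 2 ℕ.^ (r ℕ.* r) ℕ.* 2 ℕ.^ r
      ≡⟨ rearrange₂ (2 ℕ.^ (a ℕ.* m)) (2 ℕ.^ m) (2 ℕ.^ (e ℕ.* r)) (r ℕ.^ r) (2 ℕ.^ (r ℕ.* r)) (2 ℕ.^ r) ⟩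
    2 ℕ.^ (a ℕ.* m) ℕ.* (2 ℕ.^ m ℕ.* (2 ℕ.^ (e ℕ.* r) ℕ.* (2 ℕ.^ (r ℕ.* r) ℕ.* 2 ℕ.^ r))) ℕ.* r ℕ.^ r
      ≡⟨ cong (ℕ._* r ℕ.^ r) (collect (a ℕ.* m) m (e ℕ.* r) (r ℕ.* r) r) ⟩
    2 ℕ.^ (a ℕ.* m ℕ.+ (m ℕ.+ (e ℕ.* r ℕ.+ (r ℕ.* r ℕ.+ r)))) ℕ.* r ℕ.^ r
      ≤⟨ ℕ.*-monoˡ-≤ (r ℕ.^ r) (ℕ.^-monoʳ-≤ 2 exponent) ⟩
    2 ℕ.^ (r ℕ.* r ℕ.+ r ℕ.* s) ℕ.* r ℕ.^ r
      ≡⟨ cong (ℕ._* r ℕ.^ r) (sym (trans (length-allGraphs m) (cong (2 ℕ.^_) pairs≡))) ⟩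
    length (allGraphs m) ℕ.* r ℕ.^ r ∎)
    where
    open ℕ.≤-Reasoning
    m = r ℕ.+ r

    rearrange₁ : ∀ x y z → x ℕ.* y ℕ.* z ≡ x ℕ.* z ℕ.* y
    rearrange₁ = solve-∀
    rearrange₂ : ∀ x y z t u v → x ℕ.* (y ℕ.* (z ℕ.* t)) ℕ.* u ℕ.* v ≡ x ℕ.* (y ℕ.* (z ℕ.* (u ℕ.* v))) ℕ.* t
    rearrange₂ = solve-∀

    pairs≡ : pairs m ≡ r ℕ.* r ℕ.+ r ℕ.* s
    pairs≡ = subst (λ r → pairs (r ℕ.+ r) ≡ r ℕ.* r ℕ.+ r ℕ.* s) (sym r≡) (pairs-double s)

    power≤ : ∀ {x y} k → x ℕ.≤ 2 ℕ.^ y → x ℕ.^ k ℕ.≤ 2 ℕ.^ (y ℕ.* k)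
    power≤ {y = y} k x≤ = ℕ.≤-trans (ℕ.^-monoˡ-≤ k x≤) (ℕ.≤-reflexive (ℕ.^-*-assoc 2 y k))

    collect : ∀ x y z t u → 2 ℕ.^ x ℕ.* (2 ℕ.^ y ℕ.* (2 ℕ.^ z ℕ.* (2 ℕ.^ t ℕ.* 2 ℕ.^ u))) ≡
                            2 ℕ.^ (x ℕ.+ (y ℕ.+ (z ℕ.+ (t ℕ.+ u))))
    collect x y z t u = sym
      (trans (ℕ.^-distribˡ-+-* 2 x _) (cong (2 ℕ.^ x ℕ.*_)
        (trans (ℕ.^-distribˡ-+-* 2 y _) (cong (2 ℕ.^ y ℕ.*_)
          (trans (ℕ.^-distribˡ-+-* 2 z _) (cong (2 ℕ.^ z ℕ.*_) (ℕ.^-distribˡ-+-* 2 t u)))))))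

    -- Per factor `r`: `a + a` for the vertices, 2 for `2 ^ m`, `e` for the remaining `r ^ r`, and 1
    -- for the gain `2 ^ r`.
    factor : ∀ r a e → a ℕ.* (r ℕ.+ r) ℕ.+ (r ℕ.+ r ℕ.+ (e ℕ.* r ℕ.+ (r ℕ.* r ℕ.+ r))) ≡
                       r ℕ.* r ℕ.+ r ℕ.* (1 ℕ.+ (a ℕ.+ a) ℕ.+ 2 ℕ.+ e)
    factor = solve-∀

    exponent : a ℕ.* m ℕ.+ (m ℕ.+ (e ℕ.* r ℕ.+ (r ℕ.* r ℕ.+ r))) ℕ.≤ r ℕ.* r ℕ.+ r ℕ.* s
    exponent = ℕ.≤-trans (ℕ.≤-reflexive (factor r a e)) (ℕ.+-monoʳ-≤ (r ℕ.* r) (ℕ.*-monoʳ-≤ r big))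

-- Integer logarithms.

2^⌊log₂n⌋≤n : ∀ n → .{{NonZero n}} → 2 ℕ.^ ⌊log₂ n ⌋ ℕ.≤ n
2^⌊log₂n⌋≤n = <-rec P step
  where
  open ℕ.≤-Reasoning
  P : ℕ → Set
  P n = .{{NonZero n}} → 2 ℕ.^ ⌊log₂ n ⌋ ℕ.≤ n

  step : ∀ n → (∀ {m} → m ℕ.< n → P m) → P n
  step (suc zero)         rec = ℕ.≤-refl
  step n@(suc n′@(suc _)) rec = begin
    2 ℕ.^ ⌊log₂ n ⌋                  ≡⟨ cong (2 ℕ.^_) (sym (ℕ.m+[n∸m]≡n {1} (⌊log₂⌋-mono-≤ {2} {n} (s≤s (s≤s z≤n))))) ⟩
    2 ℕ.* 2 ℕ.^ (⌊log₂ n ⌋ ℕ.∸ 1)    ≡⟨ cong (λ l → 2 ℕ.* 2 ℕ.^ l) (sym (⌊log₂⌊n/2⌋⌋≡⌊log₂n⌋∸1 n)) ⟩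
    2 ℕ.* 2 ℕ.^ ⌊log₂ ⌊ n /2⌋ ⌋      ≤⟨ ℕ.*-monoʳ-≤ 2 (rec (ℕ.⌊n/2⌋<n n′)) ⟩
    2 ℕ.* ⌊ n /2⌋                    ≡⟨ cong (⌊ n /2⌋ ℕ.+_) (ℕ.+-identityʳ ⌊ n /2⌋) ⟩
    ⌊ n /2⌋ ℕ.+ ⌊ n /2⌋              ≤⟨ ℕ.+-monoʳ-≤ ⌊ n /2⌋ (ℕ.⌊n/2⌋≤⌈n/2⌉ n) ⟩
    ⌊ n /2⌋ ℕ.+ ℕ.⌈ n /2⌉            ≡⟨ ℕ.⌊n/2⌋+⌈n/2⌉≡n n ⟩
    n                                ∎

2^k≤n⇒k≤⌊log₂n⌋ : ∀ k {n} → 2 ℕ.^ k ℕ.≤ n → k ℕ.≤ ⌊log₂ n ⌋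
2^k≤n⇒k≤⌊log₂n⌋ k 2^k≤n =
  ℕ.≤-trans (ℕ.≤-reflexive (sym (⌊log₂[2^n]⌋≡n k))) (⌊log₂⌋-mono-≤ 2^k≤n)

n<2^[1+⌊log₂n⌋] : ∀ n → n ℕ.< 2 ℕ.^ suc ⌊log₂ n ⌋
n<2^[1+⌊log₂n⌋] n = ℕ.≰⇒> (ℕ.1+n≰n ∘ 2^k≤n⇒k≤⌊log₂n⌋ (suc ⌊log₂ n ⌋))

k<2^k : ∀ k → k ℕ.< 2 ℕ.^ k
k<2^k zero    = ℕ.≤-refl
k<2^k (suc k) = begin-strict
  suc k           ≤⟨ k<2^k k ⟩
  2 ℕ.^ k         <⟨ ℕ.^-monoʳ-< 2 ℕ.≤-refl (ℕ.n<1+n k) ⟩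
  2 ℕ.^ suc k     ∎
  where open ℕ.≤-Reasoning

8≤k⇒k+4≤2^k : ∀ {k} → 8 ℕ.≤ k → k ℕ.+ 4 ℕ.≤ 2 ℕ.^ k
8≤k⇒k+4≤2^k {k} 8≤k = subst (λ k → k ℕ.+ 4 ℕ.≤ 2 ℕ.^ k) (ℕ.m+[n∸m]≡n 8≤k) (begin
  8 ℕ.+ c ℕ.+ 4               ≡⟨ rearrange c ⟩
  12 ℕ.+ c                    ≤⟨ ℕ.+-mono-≤ (ℕ.m≤m+n 12 244) (ℕ.m≤n*m c 256) ⟩
  256 ℕ.+ 256 ℕ.* c           ≡⟨ sym (ℕ.*-suc 256 c) ⟩
  256 ℕ.* suc c               ≤⟨ ℕ.*-monoʳ-≤ 256 (k<2^k c) ⟩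
  256 ℕ.* 2 ℕ.^ c             ≡⟨ sym (ℕ.^-distribˡ-+-* 2 8 c) ⟩
  2 ℕ.^ (8 ℕ.+ c)             ∎)
  where
  open ℕ.≤-Reasoning
  c = k ℕ.∸ 8
  rearrange : ∀ c → 8 ℕ.+ c ℕ.+ 4 ≡ 12 ℕ.+ c
  rearrange = solve-∀

-- An integer below 2 log₂ n + 2 log₂ log₂ n: rounding costs O(1), while
-- the counting bound has a margin of about log₂ log₂ n.
lg lglg slack : ℕ → ℕ
lg n    = ⌊log₂ n ⌋
lglg n  = ⌊log₂ lg n ⌋
slack n = lg n ℕ.+ lg n ℕ.+ (lglg n ℕ.+ lglg n)

-- `AlmostAll` asks for the inclusion at every `n`, whereas the estimates below rely on
-- `8 ≤ lglg n`. The first conjunct makes the event empty for small `n`, which the limit does not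
-- see.
Typical : ∀ n → Pred (Graph n) 0ℓ
Typical n G = 8 ℕ.≤ lglg n × n ℕ.≤ ℓ G ℕ.+ slack n

typical? : ∀ n → Decidable (Typical n)
typical? n G = 8 ℕ.≤? lglg n ×-dec n ℕ.≤? ℓ G ℕ.+ slack n

8≤⌊log₂k⌋⇒NonZero : ∀ k → 8 ℕ.≤ ⌊log₂ k ⌋ → NonZero k
8≤⌊log₂k⌋⇒NonZero (suc _) _ = _

module _ {n : ℕ} (8≤b : 8 ℕ.≤ lglg n) where

  private
    a b r : ℕ
    a = lg n
    b = lglg n
    r = suc (slack n)

  2^lglg≤lg : 2 ℕ.^ lglg n ℕ.≤ lg n
  2^lglg≤lg = 2^⌊log₂n⌋≤n a {{8≤⌊log₂k⌋⇒NonZero a 8≤b}}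

  private
    b+4≤a : b ℕ.+ 4 ℕ.≤ a
    b+4≤a = ℕ.≤-trans (8≤k⇒k+4≤2^k 8≤b) 2^lglg≤lg

  2^lg≤n : 2 ℕ.^ lg n ℕ.≤ n
  2^lg≤n = 2^⌊log₂n⌋≤n n {{8≤⌊log₂k⌋⇒NonZero n (ℕ.≤-trans 8≤b (ℕ.≤-trans (ℕ.m≤m+n b 4) b+4≤a))}}

  private
    open ℕ.≤-Reasoning

    -- This makes `3 + b` the exponent `e` of the counting bound: `b + 4 ≤ a` gives `r ≤ 4 * a`, and
    -- `a < 2 ^ suc b`.
    r≤ : r ℕ.≤ 2 ℕ.^ (3 ℕ.+ b)
    r≤ = begin
      1 ℕ.+ (a ℕ.+ a ℕ.+ (b ℕ.+ b))            ≤⟨ ℕ.m≤m+n _ 7 ⟩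
      1 ℕ.+ (a ℕ.+ a ℕ.+ (b ℕ.+ b)) ℕ.+ 7      ≡⟨ rearrange₁ a b ⟩
      a ℕ.+ a ℕ.+ (b ℕ.+ 4 ℕ.+ (b ℕ.+ 4))      ≤⟨ ℕ.+-monoʳ-≤ (a ℕ.+ a) (ℕ.+-mono-≤ b+4≤a b+4≤a) ⟩
      a ℕ.+ a ℕ.+ (a ℕ.+ a)                    ≡⟨ rearrange₂ a ⟩
      4 ℕ.* a                                  ≤⟨ ℕ.*-monoʳ-≤ 4 (ℕ.<⇒≤ (n<2^[1+⌊log₂n⌋] a)) ⟩
      4 ℕ.* 2 ℕ.^ suc b                        ≡⟨ sym (ℕ.^-distribˡ-+-* 2 2 (suc b)) ⟩
      2 ℕ.^ (3 ℕ.+ b)                          ∎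
      where
      rearrange₁ : ∀ a b → 1 ℕ.+ (a ℕ.+ a ℕ.+ (b ℕ.+ b)) ℕ.+ 7 ≡ a ℕ.+ a ℕ.+ (b ℕ.+ 4 ℕ.+ (b ℕ.+ 4))
      rearrange₁ = solve-∀
      rearrange₂ : ∀ a → a ℕ.+ a ℕ.+ (a ℕ.+ a) ≡ 4 ℕ.* a
      rearrange₂ = solve-∀

    2r≤n : r ℕ.+ r ℕ.≤ n
    2r≤n = begin
      r ℕ.+ r                            ≤⟨ ℕ.+-mono-≤ r≤ r≤ ⟩
      2 ℕ.^ (3 ℕ.+ b) ℕ.+ 2 ℕ.^ (3 ℕ.+ b) ≡⟨ cong (2 ℕ.^ (3 ℕ.+ b) ℕ.+_) (sym (ℕ.+-identityʳ (2 ℕ.^ (3 ℕ.+ b)))) ⟩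
      2 ℕ.^ (4 ℕ.+ b)                    ≤⟨ ℕ.^-monoʳ-≤ 2 (ℕ.≤-trans (ℕ.≤-reflexive (ℕ.+-comm 4 b)) b+4≤a) ⟩
      2 ℕ.^ a                            ≤⟨ 2^lg≤n ⟩
      n                                  ∎

    -- The floor only gives `n < 2 ^ suc a`, hence `suc a`; and `e` is `3 + b`. The constants 1, 2,
    -- 2, 3 add up to 8 and are absorbed by the second `b` in `slack n`, whence the threshold 8.
    big : 1 ℕ.+ (suc a ℕ.+ suc a) ℕ.+ 2 ℕ.+ (3 ℕ.+ b) ℕ.≤ slack n
    big = begin
      1 ℕ.+ (suc a ℕ.+ suc a) ℕ.+ 2 ℕ.+ (3 ℕ.+ b) ≡⟨ rearrange a b ⟩
      a ℕ.+ a ℕ.+ (8 ℕ.+ b)                       ≤⟨ ℕ.+-monoʳ-≤ (a ℕ.+ a) (ℕ.+-monoˡ-≤ b 8≤b) ⟩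
      slack n                                     ∎
      where
      rearrange : ∀ a b → 1 ℕ.+ (suc a ℕ.+ suc a) ℕ.+ 2 ℕ.+ (3 ℕ.+ b) ≡ a ℕ.+ a ℕ.+ (8 ℕ.+ b)
      rearrange = solve-∀

  atypical⇒repetitive : ∀ {G : Graph n} → ¬ Typical n G → Repetitive (suc (slack n)) G
  atypical⇒repetitive {G} ¬typical = ℓ G ,
    -- Failure of `n ≤ ℓ G + slack n` is a strict inequality, which supplies the extra 1 in
    -- `suc (slack n)`.
    ℕ.≤-trans (ℕ.≤-reflexive (ℕ.+-suc (ℓ G) (slack n))) (ℕ.≰⇒> (¬typical ∘ (8≤b ,_))) ,
    proj₁ (ℓ-isLettericity G)

  count-atypical : length (filter (¬? ∘ typical? n) (allGraphs n)) ℕ.* 2 ℕ.^ suc (slack n)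
                     ℕ.≤ length (allGraphs n)
  count-atypical = ℕ.*-cancelʳ-≤ _ _ M {{allGraphs-nonZero (r ℕ.+ r)}} (begin
    B ℕ.* 2 ℕ.^ r ℕ.* M      ≡⟨ rearrange₁ B (2 ℕ.^ r) M ⟩
    B ℕ.* M ℕ.* 2 ℕ.^ r      ≤⟨ ℕ.*-monoˡ-≤ (2 ℕ.^ r)
                                  (count-repetitive n r (¬? ∘ typical? n) 2r≤n (λ {G} → atypical⇒repetitive {G})) ⟩
    C ℕ.* N ℕ.* 2 ℕ.^ r      ≡⟨ rearrange₂ C N (2 ℕ.^ r) ⟩
    N ℕ.* (C ℕ.* 2 ℕ.^ r)    ≤⟨ ℕ.*-monoʳ-≤ N (length-codes-small refl
                                  (ℕ.<⇒≤ (n<2^[1+⌊log₂n⌋] n)) r≤ big) ⟩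
    N ℕ.* M                  ∎)
    where
    B = length (filter (¬? ∘ typical? n) (allGraphs n))
    C = length (codes n r)
    M = length (allGraphs (r ℕ.+ r))
    N = length (allGraphs n)
    rearrange₁ : ∀ x y z → x ℕ.* y ℕ.* z ≡ x ℕ.* z ℕ.* y
    rearrange₁ = solve-∀
    rearrange₂ : ∀ x y z → x ℕ.* y ℕ.* z ≡ y ℕ.* (x ℕ.* z)
    rearrange₂ = solve-∀

-- Convergence of the probability.

length-filter-complement : ∀ {A : Set} {P : Pred A 0ℓ} (P? : Decidable P) xs →
  length (filter P? xs) ℕ.+ length (filter (¬? ∘ P?) xs) ≡ length xs
length-filter-complement P? []       = refl
length-filter-complement P? (x ∷ xs) with P? x
... | yes _ = cong suc (length-filter-complement P? xs)
... | no _  = trans (ℕ.+-suc _ _) (cong suc (length-filter-complement P? xs))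

-- The distance to 1 is `y / d`. A positive `ε` has numerator at least 1, so it suffices to stay
-- below 1 over its denominator.
∣x/d-1∣<ε : ∀ {x y d} .{{_ : NonZero d}} (ε : ℚᵘ) → ℚ.Positive ε → x ℕ.+ y ≡ d →
            y ℕ.* ↧ₙ ε ℕ.< d → ℚ.∣ (+ x ℚ./ d) ℚ.- 1ℚᵘ ∣ ℚ.< ε
∣x/d-1∣<ε {x} {y} {suc d} (mkℚᵘ ℤ.+[1+ p ] q) _ x+y≡d y*q<d = *<* (begin-strict
  + ℤ.∣ + x ℤ.* + 1 ℤ.+ -[1+ 0 ] ℤ.* + suc d ∣ ℤ.* + suc q
    ≡⟨ cong (λ z → + z ℤ.* + suc q) gap ⟩
  + y ℤ.* + suc q
    ≡⟨ sym (ℤ.pos-* y (suc q)) ⟩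
  + (y ℕ.* suc q)
    <⟨ ℤ.+<+ y*q<d ⟩
  + suc d
    ≤⟨ ℤ.+≤+ (ℕ.≤-trans (ℕ.≤-reflexive (sym (ℕ.*-identityʳ (suc d)))) (ℕ.m≤n*m _ (suc p))) ⟩
  + (suc p ℕ.* (suc d ℕ.* 1)) ∎)
  where
  open ℤ.≤-Reasoning
  simplify : ∀ x y → x ℤ.* + 1 ℤ.+ -[1+ 0 ] ℤ.* (x ℤ.+ y) ≡ ℤ.- y
  simplify = ℤSolver.solve-∀
  gap : ℤ.∣ + x ℤ.* + 1 ℤ.+ -[1+ 0 ] ℤ.* + suc d ∣ ≡ y
  gap = trans (cong (λ d → ℤ.∣ + x ℤ.* + 1 ℤ.+ -[1+ 0 ] ℤ.* + d ∣) (sym x+y≡d))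
    (trans (cong ℤ.∣_∣ (simplify (+ x) (+ y))) (ℤ.∣-i∣≡∣i∣ (+ y)))

j≤k∧m*2^k≤n⇒m*j<n : ∀ {m j k n} .{{_ : NonZero n}} → j ℕ.≤ k → m ℕ.* 2 ℕ.^ k ℕ.≤ n → m ℕ.* j ℕ.< n
j≤k∧m*2^k≤n⇒m*j<n {zero}              _   _      = ℕ.>-nonZero⁻¹ _
j≤k∧m*2^k≤n⇒m*j<n {suc m} {j} {k} {n} j≤k m*2^k≤n = begin-strict
  suc m ℕ.* j        ≤⟨ ℕ.*-monoʳ-≤ (suc m) j≤k ⟩
  suc m ℕ.* k        <⟨ ℕ.*-monoʳ-< (suc m) (k<2^k k) ⟩
  suc m ℕ.* 2 ℕ.^ k  ≤⟨ m*2^k≤n ⟩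
  n                  ∎
  where open ℕ.≤-Reasoning

eventually : ∀ j k → ∃[ N ] (∀ n → N ℕ.≤ n → j ℕ.≤ lglg n × k ℕ.≤ lg n)
eventually j k = 2 ℕ.^ (2 ℕ.^ j) ℕ.+ 2 ℕ.^ k , λ n N≤n →
  2^k≤n⇒k≤⌊log₂n⌋ j (2^k≤n⇒k≤⌊log₂n⌋ (2 ℕ.^ j) (ℕ.m+n≤o⇒m≤o (2 ℕ.^ (2 ℕ.^ j)) N≤n)) ,
  2^k≤n⇒k≤⌊log₂n⌋ k (ℕ.m+n≤o⇒n≤o (2 ℕ.^ (2 ℕ.^ j)) N≤n)

Pr-typical : (λ n → Pr (typical? n)) ⟶ 1ℚᵘ
Pr-typical ε 0<ε = limit (eventually 8 q)
  where
  q = ↧ₙ ε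
  B : ℕ → ℕ
  B n = length (filter (¬? ∘ typical? n) (allGraphs n))

  small : ∀ n → 8 ℕ.≤ lglg n → q ℕ.≤ lg n → B n ℕ.* q ℕ.< length (allGraphs n)
  -- The exponent of the gain in `count-atypical` exceeds `lg n`, hence the denominator `q` of `ε`.
  small n 8≤b q≤a = j≤k∧m*2^k≤n⇒m*j<n {B n} {{allGraphs-nonZero n}}
    (ℕ.m≤n⇒m≤1+n (ℕ.≤-trans q≤a (ℕ.≤-trans (ℕ.m≤m+n (lg n) (lg n)) (ℕ.m≤m+n _ (lglg n ℕ.+ lglg n)))))
    (count-atypical {n} 8≤b)

  limit : ∃[ N ] (∀ n → N ℕ.≤ n → 8 ℕ.≤ lglg n × q ℕ.≤ lg n) →
          ∃[ N ] (∀ n → N ℕ.≤ n → ℚ.∣ Pr (typical? n) ℚ.- 1ℚᵘ ∣ ℚ.< ε)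
  limit (N , large) = N , λ n N≤n →
    ∣x/d-1∣<ε {x = length (filter (typical? n) (allGraphs n))} {y = B n} {d = length (allGraphs n)}
      {{allGraphs-nonZero n}} ε (ℚ.positive 0<ε)
      (length-filter-complement (typical? n) (allGraphs n))
      (uncurry (small n) (large n N≤n))

-- Lower bounds on cuts

fromℕ-^ : ∀ m k → (+ m ℚ./ 1) ^ k ≡ + (m ℕ.^ k) ℚ./ 1
fromℕ-^ m zero    = refl
fromℕ-^ m (suc k) = trans (cong ((+ m ℚ./ 1) ℚ.*_) (fromℕ-^ m k))
  (cong (λ z → mkℚᵘ z 0) (sym (ℤ.pos-* m (m ℕ.^ k))))

/1-mono-≤ : ∀ {m n} → m ℕ.≤ n → + m ℚ./ 1 ℚ.≤ + n ℚ./ 1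
/1-mono-≤ {m} {n} m≤n = *≤* (ℤ.*-monoʳ-≤-nonNeg (+ 1) (ℤ.+≤+ m≤n))

^-monoˡ-≤ : ∀ {p q} → 0ℚᵘ ℚ.≤ p → p ℚ.≤ q → ∀ k → 0ℚᵘ ℚ.≤ p ^ k × p ^ k ℚ.≤ q ^ k
^-monoˡ-≤ 0≤p p≤q zero    = ℚ.nonNegative⁻¹ 1ℚᵘ , ℚ.≤-refl
^-monoˡ-≤ {p} {q} 0≤p p≤q (suc k) with 0≤p^k , p^k≤q^k ← ^-monoˡ-≤ 0≤p p≤q k =
  ℚ.≤-respˡ-≃ (ℚ.*-zeroʳ p) (ℚ.*-monoʳ-≤-nonNeg p {{ℚ.nonNegative 0≤p}} 0≤p^k) ,
  ℚ.*-mono-≤-nonNeg {{ℚ.nonNegative 0≤p}} {{ℚ.nonNegative 0≤p^k}} p≤q p^k≤q^k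

0≤n/1 : ∀ n → 0ℚᵘ ℚ.≤ + n ℚ./ 1
0≤n/1 n = /1-mono-≤ z≤n

pow2-bound : ∀ z k → z ℤ.< + k → pow2 z ℚ.≤ + (2 ℕ.^ k) ℚ./ 1
pow2-bound (+ j) k (ℤ.+<+ j<k) = ℚ.≤-trans (ℚ.≤-reflexive (ℚ.≃-reflexive (fromℕ-^ 2 j)))
  (/1-mono-≤ (ℕ.^-monoʳ-≤ 2 (ℕ.<⇒≤ j<k)))
pow2-bound -[1+ j ] k _ = ℚ.≤-trans
  (proj₂ (^-monoˡ-≤ {q = 1ℚᵘ} (ℚ.nonNegative⁻¹ ℚ.½) (*≤* (ℤ.+≤+ (s≤s z≤n))) (suc j)))
  (ℚ.≤-trans (ℚ.≤-reflexive (ℚ.≃-reflexive (trans (fromℕ-^ 1 (suc j)) (cong (λ z → + z ℚ./ 1) (ℕ.^-zeroˡ (suc j))))))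
    (/1-mono-≤ (ℕ.m^n>0 2 k)))

-- The upper cut is the one constrained because the logarithms are subtracted in the theorem, and
-- `lower (- x)` is defined by `upper x`.
record LowerBound (k : ℕ) (x : Cut) : Set where
  constructor lowerBound
  field
    upper⇒≥ : ∀ {q} → upper x q → + k ℚ./ 1 ℚ.≤ q

open LowerBound

-- If `q` = a/b were below `k`, then 2^a ≤ (2^k)^b ≤ r^b, against r^b < 2^a for the witness `r` of
-- `upper (log₂ x) q`.
log₂-lowerBound : ∀ {k x} → LowerBound (2 ℕ.^ k) x → LowerBound k (log₂ x)
log₂-lowerBound {k} bound .upper⇒≥ {q@record{}} (r , x<r , _ , r^b<2^a) = ℚ.≮⇒≥ λ q<k →
  ℚ.<⇒≱ r^b<2^a (begin
    pow2 (↥ q)                        ≤⟨ pow2-bound (↥ q) (k ℕ.* ↧ₙ q) (numerator q<k) ⟩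
    + (2 ℕ.^ (k ℕ.* ↧ₙ q)) ℚ./ 1      ≡⟨ cong (λ z → + z ℚ./ 1) (sym (ℕ.^-*-assoc 2 k (↧ₙ q))) ⟩
    + ((2 ℕ.^ k) ℕ.^ ↧ₙ q) ℚ./ 1      ≡⟨ sym (fromℕ-^ (2 ℕ.^ k) (↧ₙ q)) ⟩
    (+ (2 ℕ.^ k) ℚ./ 1) ^ ↧ₙ q        ≤⟨ proj₂ (^-monoˡ-≤ (0≤n/1 (2 ℕ.^ k)) (upper⇒≥ bound x<r) (↧ₙ q)) ⟩
    r ^ ↧ₙ q                          ∎)
  where
  open ℚ.≤-Reasoning
  numerator : q ℚ.< + k ℚ./ 1 → ↥ q ℤ.< + (k ℕ.* ↧ₙ q)
  numerator (*<* a*1<k*b) = subst₂ ℤ._<_ (ℤ.*-identityʳ (↥ q)) (sym (ℤ.pos-* k (↧ₙ q))) a*1<k*b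

+-lowerBound : ∀ {j k x y} → LowerBound j x → LowerBound k y → LowerBound (j ℕ.+ k) (x + y)
+-lowerBound {j} {k} x-bound y-bound .upper⇒≥ (r , s , x<r , y<s , r+s≤q) =
  ℚ.≤-trans (ℚ.≤-reflexive (*≡* (expand (+ j) (+ k))))
    (ℚ.≤-trans (ℚ.+-mono-≤ (upper⇒≥ x-bound x<r) (upper⇒≥ y-bound y<s)) r+s≤q)
  where
  expand : ∀ x y → (x ℤ.+ y) ℤ.* + 1 ≡ (x ℤ.* + 1 ℤ.+ y ℤ.* + 1) ℤ.* + 1
  expand = ℤSolver.solve-∀

n-x≤k : ∀ {n j k x} → LowerBound j x → n ℕ.≤ k ℕ.+ j → fromℕ n - x ≤ fromℕ k
n-x≤k {n} {j} {k} bound n≤k+j {q} (r , s , r<n , x<-s , q≤r+s) = begin-strict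
  q                                          ≤⟨ q≤r+s ⟩
  -- The lower cut of `fromℕ k` is open; `r < n` supplies the strictness.
  r ℚ.+ s                                    <⟨ ℚ.+-monoˡ-< s r<n ⟩
  (+ n ℚ./ 1) ℚ.+ s                          ≡⟨ cong ((+ n ℚ./ 1) ℚ.+_) (sym (ℚ.neg-involutive-≡ s)) ⟩
  (+ n ℚ./ 1) ℚ.- (ℚ.- s)                    ≤⟨ ℚ.+-mono-≤ (/1-mono-≤ n≤k+j) (ℚ.neg-mono-≤ (upper⇒≥ bound x<-s)) ⟩
  (+ (k ℕ.+ j) ℚ./ 1) ℚ.- (+ j ℚ./ 1)        ≃⟨ *≡* (cancel (+ k) (+ j)) ⟩
  + k ℚ./ 1                                  ∎
  where
  open ℚ.≤-Reasoning
  cancel : ∀ x y → ((x ℤ.+ y) ℤ.* + 1 ℤ.+ (ℤ.- y) ℤ.* + 1) ℤ.* + 1 ≡ x ℤ.* + 1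
  cancel = ℤSolver.solve-∀

theorem3p2p6 : AlmostAll (λ {n} G →
    fromℕ (ℓ G) ≥ fromℕ n - (2· log₂ (fromℕ n) + 2· log₂ (log₂ (fromℕ n))))
theorem3p2p6 = Typical , typical? , typical⇒ , Pr-typical
  where
  typical⇒ : ∀ n {G} → Typical n G →
    fromℕ (ℓ G) ≥ fromℕ n - (2· log₂ (fromℕ n) + 2· log₂ (log₂ (fromℕ n)))
  typical⇒ n {G} (8≤b , n≤ℓ+slack) = n-x≤k
    -- `slack n` is bracketed exactly like this sum of cuts, so the bounds match without
    -- rearrangement.
    (+-lowerBound (+-lowerBound log-bound log-bound) (+-lowerBound loglog-bound loglog-bound))
    n≤ℓ+slack
    where
    log-bound : LowerBound (lg n) (log₂ (fromℕ n))
    log-bound = log₂-lowerBound (lowerBound λ n<q → ℚ.≤-trans (/1-mono-≤ (2^lg≤n {n} 8≤b)) (ℚ.<⇒≤ n<q))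

    loglog-bound : LowerBound (lglg n) (log₂ (log₂ (fromℕ n)))
    loglog-bound = log₂-lowerBound (lowerBound λ n<q →
      ℚ.≤-trans (/1-mono-≤ (2^lglg≤lg {n} 8≤b)) (upper⇒≥ log-bound n<q))
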